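{- For every positive integer $n$ there is a bijection $\phi'$ between $\mathcal{T}^0_n$ and $\mathcal{S}_n$ such that if $\tau\in\mathcal{T}^0_n$ and $\sigma=\phi'(\tau)$, then $$D(\tau)=D(\sigma).$$ Additionally, if $0$ is in position $k$ of $\tau$, then $\sigma(k)=1$.
   Context: $\mathcal{S}_n$ is the set of permutations of $[n]=\{1,\dots,n\}$. $\mathcal{T}^0_n$ is the set of all sequences of length $n$ obtained by taking the one-line notation $\pi(1)\pi(2)\dots\pi(n)$ of a permutation $\pi\in\mathcal{S}_n$ consisting of a single $n$-cycle and replacing exactly one entry with $0$; for example $\mathcal{T}^0_3=\{031,201,230,012,302,310\}$. For a sequence of integers $a=a_1a_2\dots a_n$ (in particular for a permutation in one-line notation), $D(a)=\{i : 1\le i\le n-1,\ a_i>a_{i+1}\}$. -}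

module Defs where

open import Data.Fin.Base using (Fin; suc; inject₁; toℕ)
open import Data.Fin.Permutation using (Permutation′; _⟨$⟩ʳ_)
open import Data.Nat.Base using (ℕ; suc; _∸_; _>_; NonZero)
open import Data.Nat.DivMod using (_mod_)
open import Data.Product.Base using (∃; ∃-syntax; _×_; proj₁)
open import Data.Vec.Base using (Vec; lookup; tabulate; _[_]≔_)
open import Level using (0ℓ)
open import Relation.Binary.Bundles using (Setoid)
import Relation.Binary.Construct.On as On
open import Relation.Binary.PropositionalEquality using (_≡_; setoid; _→-setoid_)
open import Relation.Unary using (Pred)

-- The element i of [n] is represented by the j : Fin n with i = suc (toℕ j);
-- sequences keep their actual integer entries, so that 0 is available as an
-- entry distinct from 1, …, n.
oneLine : ∀ {n} → Permutation′ n → Vec ℕ n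
oneLine π = tabulate (λ i → suc (toℕ (π ⟨$⟩ʳ i)))

𝒮 : ℕ → Setoid 0ℓ 0ℓ
𝒮 n = On.setoid {B = Permutation′ n} (Fin n →-setoid Fin n) _⟨$⟩ʳ_

-- π = (c₁ c₂ … cₙ) for some ordering c₁, …, cₙ of all the elements of [n]:
-- π sends each entry of the cycle to the next one, and the last to the first.
IsCyclic : ∀ {n} .{{_ : NonZero n}} → Permutation′ n → Set
IsCyclic {n} π =
  ∃ λ (c : Permutation′ n) → ∀ (i : Fin n) → π ⟨$⟩ʳ (c ⟨$⟩ʳ i) ≡ c ⟨$⟩ʳ ((suc (toℕ i)) mod n)

Is𝒯⁰ : ∀ {n} .{{_ : NonZero n}} → Pred (Vec ℕ n) 0ℓ
Is𝒯⁰ {n} a = ∃[ π ] ∃[ k ] IsCyclic {n} π × a ≡ oneLine π [ k ]≔ 0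

-- Elements are compared as sequences, whatever the permutation and position
-- they were obtained from.
𝒯⁰ : ∀ n .{{_ : NonZero n}} → Setoid 0ℓ 0ℓ
𝒯⁰ n = On.setoid {B = ∃ (Is𝒯⁰ {n})} (setoid (Vec ℕ n)) proj₁

-- The descent set; i : Fin (n ∸ 1) stands for the position suc (toℕ i).
D : ∀ {n} → Vec ℕ n → Pred (Fin (n ∸ 1)) 0ℓ
D {suc n} a i = lookup a (inject₁ i) > lookup a (suc i)

{-# OPTIONS --safe #-}
module Submission where

open import Defs
import Data.Bool.Base as Bool
open import Data.Bool.Base using (Bool; true; false)
import Data.Bool.Properties as Bool
open import Data.Fin.Base using
  (Fin; zero; suc; toℕ; fromℕ; fromℕ<; inject₁; inject≤; opposite; punchIn; punchOut; combine
  ; remQuot; _≤_; _<_)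
open import Data.Fin.Induction using (<-weakInduction; >-weakInduction)
import Data.Fin.Permutation as Perm
open import Data.Fin.Permutation using
  (Permutation′; _⟨$⟩ʳ_; _⟨$⟩ˡ_; _≈_; permutation; flip; reverse; _∘ₚ_; insert; remove
  ; insert-punchIn; insert-remove; inverseˡ; inverseʳ)
import Data.Fin.Properties as Fin
open import Data.Fin.Properties using
  (_≟_; <-cmp; any?; toℕ-injective; toℕ<n; toℕ-fromℕ; toℕ-fromℕ<; toℕ-inject₁; toℕ-inject≤
  ; inject≤-injective; fromℕ<-injective; fromℕ≢inject₁; opposite-involutive; punchOut-injective
  ; punchIn-injective; injective⇒≤; combine-remQuot; remQuot-combine)
open import Data.Fin.Relation.Unary.Top using (view; view-fromℕ; view-inject₁; ‵fromℕ; ‵inject₁)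
import Data.Fin.Subset as Subset
open import Data.Fin.Subset using (Subset)
open import Data.Fin.Subset.Properties using (p⊂q⇒∣p∣<∣q∣; ∈⊤; ∣⊤∣≡n)
import Data.List.Base as List
open import Data.List.Base using (List; []; _∷_; filter; length; allFin)
open import Data.List.Membership.Propositional using (_∈_)
open import Data.List.Membership.Propositional.Properties using
  (∈-filter⁺; ∈-filter⁻; ∈-allFin; ∈-lookup; ∈-tabulate⁻)
import Data.List.Properties as List
open import Data.List.Properties using (map-tabulate; length-tabulate; ∷-injectiveˡ; ∷-injectiveʳ)
open import Data.List.Relation.Binary.Lex.Strict using (halt; this; next; xs≮[]; <-strictTotalOrder)
open import Data.List.Relation.Binary.Permutation.Propositional using
  (_↭_; refl; prep; ↭-sym; ↭-trans; module PermutationReasoning)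
open import Data.List.Relation.Binary.Permutation.Propositional.Properties using
  (↭-map-inv; map⁺; ++⁺; shift; ∈-resp-↭)
open import Data.List.Relation.Binary.Pointwise using (Pointwise-≡⇒≡; ≡⇒Pointwise-≡)
import Data.List.Relation.Unary.All as All
open import Data.List.Relation.Unary.AllPairs using ([]; _∷_)
open import Data.List.Relation.Unary.Any using (index)
open import Data.List.Relation.Unary.Any.Properties using (lookup-index)
open import Data.List.Relation.Unary.Unique.Propositional using (Unique)
open import Data.List.Relation.Unary.Unique.Propositional.Properties using (filter⁺; allFin⁺)
open import Data.Nat.Base as ℕ using (ℕ; zero; suc; NonZero; _+_; _!)
open import Data.Nat.DivMod using (_mod_; _%_; m%n<n; n%n≡0; m<n⇒m%n≡m)
import Data.Nat.Properties as ℕ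
open import Data.Product.Base using (Σ-syntax; ∃; _×_; _,_; proj₁; proj₂)
import Data.Vec.Base as Vec
open import Data.Vec.Base using (Vec; []; _∷_; lookup; tabulate; _[_]≔_; _++_)
open import Data.Vec.Properties using
  (lookup∘tabulate; tabulate∘lookup; tabulate-cong; lookup∘update; lookup∘update′; lookup⇒[]=
  ; []=⇒lookup; ++-injective)
import Data.Vec.Relation.Binary.Pointwise.Inductive as Pointwise
open import Data.Vec.Relation.Binary.Pointwise.Inductive using (Pointwise)
open import Function.Base using (_∘_)
open import Function.Bundles using (Bijection; mk⇔)
open import Function.Definitions using (Injective)
open import Level using (0ℓ)
open import Relation.Binary.Bundles using (Setoid; StrictTotalOrder)
open import Relation.Binary.Definitions using (tri<; tri≈; tri>)
open import Relation.Binary.PropositionalEquality using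
  (_≡_; _≢_; _≗_; refl; sym; trans; cong; cong₂; subst; subst₂; module ≡-Reasoning)
open import Relation.Nullary using (Dec; does; yes; no; contradiction)
open import Relation.Nullary.Decidable using (dec-true; dec-false; does-⇔)
open import Relation.Unary using (Pred; Decidable; _≐_)

-- A permutation p of [n] encodes the cycle (0 p₁ … pₙ) on {0, …, n}, hence the
-- sequence τ with τ(pᵢ) = pᵢ₊₁ and τ(pₙ) = 0; it also encodes the permutation σ
-- with σ(pᵢ) = n + 1 − i.  Fix a set I of positions, cutting [n] into blocks.
-- Following Gessel and Reutenauer, if D(τ) ⊆ I then p is determined by the word
-- w of the blocks of p₁, …, pₙ: it ranks the suffixes of w lexicographically.
-- Likewise, if D(σ) ⊆ I then p ranks the pairs (wᵢ, n − i).  In both cases pₙ is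
-- the first element of its block.  So for every I and k there are as many τ with
-- D(τ) ⊆ I and τ(k) = 0 as σ with D(σ) ⊆ I and σ(k) = 1, and inclusion–exclusion
-- over I turns these equalities into a bijection preserving D and k.

-- Write b for the map from positions to blocks and w for the word b ∘ p. The two sequences attached
-- to p have a common description: position p(i) receives a value depending on i, the last index
-- receives the least value, and inside a block values compare as the tie-breaks of equal letters of
-- w do. Hence the descents lie in I exactly when p lists positions in the order of the keys made of
-- a letter and its tie-break (`descents⊑⇒sorted`, `sorted⇒descents⊑`). For σ the tie-break is the
-- index, reversed. For τ it is the part of w after i: since τ(p(i)) = p(i+1), comparing values
-- means comparing the next suffixes.
--
-- Such a p is determined by its word (`sorted-unique`), and every word b ∘ p comes from one
-- (`sort`). Passing to the permutation with the same word that is sorted for the other reading is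
-- therefore injective, in both directions. It keeps the image of the last index, which is the first
-- element of its block in either reading (`last-minimal`). So the descent set and the place of the
-- least entry, encoded together as a Boolean vector, are jointly equidistributed
-- (`#below-determines`), and any matching of equal vectors gives the bijection.

private
  variable
    m n N : ℕ

-- Injective self-maps of finite sets

-- Surjectivity is the pigeonhole principle: if `y` were missed, punching it out would inject
-- `Fin (suc n)` into `Fin n`.
injective⇒permutation : (f : Fin n → Fin n) → Injective _≡_ _≡_ f →
                        Σ[ π ∈ Permutation′ n ] (π ⟨$⟩ʳ_ ≗ f)
injective⇒permutation {n} f inj =
  permutation f (proj₁ ∘ surj f inj) (proj₂ ∘ surj f inj) (λ x → inj (proj₂ (surj f inj (f x)))) , λ _ → refl
  where
  surj : ∀ {n} (f : Fin n → Fin n) → Injective _≡_ _≡_ f → ∀ y → ∃ λ x → f x ≡ y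
  surj {suc n} f inj y with any? (λ x → f x ≟ y)
  ... | yes hit = hit
  ... | no miss = contradiction
    (injective⇒≤ {f = λ x → punchOut (avoid x)} (λ {x} {x′} eq → inj (punchOut-injective (avoid x) (avoid x′) eq)))
    (ℕ.<⇒≱ (ℕ.n<1+n n))
    where
    avoid : ∀ x → y ≢ f x
    avoid x y≡fx = miss (x , sym y≡fx)

permutation-injective : (π : Permutation′ n) → Injective _≡_ _≡_ (π ⟨$⟩ʳ_)
permutation-injective π eq = trans (sym (inverseˡ π)) (trans (cong (π ⟨$⟩ˡ_) eq) (inverseˡ π))

-- Enumeration of permutations

-- A mixed-radix code: the quotient of the index by `n !` is the image of `zero`, and the remainder
-- codes the rest. Indices in a finite type let permutations be counted up to `≈`.
enumerate : ∀ n → Fin (n !) → Permutation′ n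
enumerate zero    _ = Perm.id
enumerate (suc n) i =
  insert zero (proj₁ (remQuot {suc n} (n !) i)) (enumerate n (proj₂ (remQuot {suc n} (n !) i)))

enumerate-injective : ∀ n {i j} → enumerate n i ≈ enumerate n j → i ≡ j
enumerate-injective zero    {zero} {zero} _ = refl
enumerate-injective (suc n) {i} {j} eq = begin
  i                      ≡⟨ combine-remQuot {suc n} (n !) i ⟨
  combine (q i) (r i)    ≡⟨ cong₂ combine (eq zero) (enumerate-injective n tail) ⟩
  combine (q j) (r j)    ≡⟨ combine-remQuot {suc n} (n !) j ⟩
  j                      ∎
  where
  open ≡-Reasoning
  q : Fin (suc n !) → Fin (suc n)
  q i = proj₁ (remQuot {suc n} (n !) i)
  r : Fin (suc n !) → Fin (n !)
  r i = proj₂ (remQuot {suc n} (n !) i)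
  tail : enumerate n (r i) ≈ enumerate n (r j)
  tail k = punchIn-injective (q i) _ _ (begin
    punchIn (q i) (enumerate n (r i) ⟨$⟩ʳ k)  ≡⟨ insert-punchIn zero (q i) (enumerate n (r i)) k ⟨
    enumerate (suc n) i ⟨$⟩ʳ suc k            ≡⟨ eq (suc k) ⟩
    enumerate (suc n) j ⟨$⟩ʳ suc k            ≡⟨ insert-punchIn zero (q j) (enumerate n (r j)) k ⟩
    punchIn (q j) (enumerate n (r j) ⟨$⟩ʳ k)  ≡⟨ cong (λ x → punchIn x (enumerate n (r j) ⟨$⟩ʳ k)) (eq zero) ⟨
    punchIn (q i) (enumerate n (r j) ⟨$⟩ʳ k)  ∎)

insert-cong : ∀ j {π ρ : Permutation′ n} → π ≈ ρ → insert zero j π ≈ insert zero j ρ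
insert-cong j         π≈ρ zero    = refl
insert-cong j {π} {ρ} π≈ρ (suc k) =
  trans (insert-punchIn zero j π k) (trans (cong (punchIn j) (π≈ρ k)) (sym (insert-punchIn zero j ρ k)))

enumerate-surjective : ∀ n (π : Permutation′ n) → ∃ λ i → enumerate n i ≈ π
enumerate-surjective zero    π = zero , λ ()
enumerate-surjective (suc n) π
  with i , eq ← enumerate-surjective n (remove zero π)
  = combine (π ⟨$⟩ʳ zero) i , λ k → begin
    enumerate (suc n) (combine (π ⟨$⟩ʳ zero) i) ⟨$⟩ʳ k
      ≡⟨ cong (λ x → insert zero (proj₁ x) (enumerate n (proj₂ x)) ⟨$⟩ʳ k) (remQuot-combine (π ⟨$⟩ʳ zero) i) ⟩
    insert zero (π ⟨$⟩ʳ zero) (enumerate n i) ⟨$⟩ʳ k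
      ≡⟨ insert-cong (π ⟨$⟩ʳ zero) eq k ⟩
    insert zero (π ⟨$⟩ʳ zero) (remove zero π) ⟨$⟩ʳ k
      ≡⟨ insert-remove zero π k ⟩
    π ⟨$⟩ʳ k ∎
  where open ≡-Reasoning

lookup-injective : ∀ {A : Set} {xs : List A} → Unique xs → Injective _≡_ _≡_ (List.lookup xs)
lookup-injective (_  ∷ _) {zero}  {zero}  _  = refl
lookup-injective (x∉ ∷ _) {zero}  {suc j} eq = contradiction eq (All.lookup x∉ (∈-lookup j))
lookup-injective (x∉ ∷ _) {suc i} {zero}  eq = contradiction (sym eq) (All.lookup x∉ (∈-lookup i))
lookup-injective (_  ∷ u) {suc i} {suc j} eq = cong suc (lookup-injective u eq)

-- Multisets of Boolean vectors

infix 4 _≼_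

_≼_ : ∀ {A B : Set} → Pred A 0ℓ → Pred B 0ℓ → Set
P ≼ Q = Σ[ f ∈ (∀ x → P x → ∃ Q) ] (∀ {x y} px py → proj₁ (f x px) ≡ proj₁ (f y py) → x ≡ y)

count : ∀ {P : Pred (Fin N) 0ℓ} → Decidable P → ℕ
count {N} P? = length (filter P? (allFin N))

count-mono : ∀ {P Q : Pred (Fin N) 0ℓ} (P? : Decidable P) (Q? : Decidable Q) → P ≼ Q → count P? ℕ.≤ count Q?
count-mono {N} {P} {Q} P? Q? (f , inj) = injective⇒≤ {f = h} h-injective
  where
  xs = filter P? (allFin N)
  p : ∀ i → P (List.lookup xs i)
  p i = proj₂ (∈-filter⁻ P? {xs = allFin N} (∈-lookup i))
  member : ∀ i → proj₁ (f _ (p i)) ∈ filter Q? (allFin N)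
  member i = ∈-filter⁺ Q? (∈-allFin _) (proj₂ (f _ (p i)))
  h : Fin (count P?) → Fin (count Q?)
  h i = index (member i)
  h-injective : Injective _≡_ _≡_ h
  h-injective {i} {j} eq = lookup-injective (filter⁺ P? (allFin⁺ N))
    (inj (p i) (p j) (trans (lookup-index (member i))
      (trans (cong (List.lookup (filter Q? (allFin N))) eq) (sym (lookup-index (member j))))))

infix 4 _⊑_ _⊑?_

_⊑_ : Vec Bool m → Vec Bool m → Set
_⊑_ = Pointwise Bool._≤_

_⊑?_ : (u v : Vec Bool m) → Dec (u ⊑ v)
_⊑?_ = Pointwise.decidable Bool._≤?_

#below : Vec Bool m → List (Vec Bool m) → ℕ
#below J us = length (filter (_⊑? J) us)

tails : Bool → List (Vec Bool (suc m)) → List (Vec Bool m)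
tails b     []                 = []
tails false ((false ∷ u) ∷ us) = u ∷ tails false us
tails false ((true  ∷ u) ∷ us) = tails false us
tails true  ((false ∷ u) ∷ us) = tails true us
tails true  ((true  ∷ u) ∷ us) = u ∷ tails true us

#below-false : ∀ J (us : List (Vec Bool (suc m))) → #below (false ∷ J) us ≡ #below J (tails false us)
#below-false J []                 = refl
#below-false J ((false ∷ u) ∷ us) with does (u ⊑? J)
... | true  = cong suc (#below-false J us)
... | false = #below-false J us
#below-false J ((true ∷ u) ∷ us)  = #below-false J us

#below-true : ∀ J (us : List (Vec Bool (suc m))) →
              #below (true ∷ J) us ≡ #below J (tails false us) + #below J (tails true us)
#below-true J []                 = refl
#below-true J ((false ∷ u) ∷ us) with does (u ⊑? J)
... | true  = cong suc (#below-true J us)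
... | false = #below-true J us
#below-true J ((true ∷ u) ∷ us)  with does (u ⊑? J)
... | true  = trans (cong suc (#below-true J us)) (sym (ℕ.+-suc _ _))
... | false = #below-true J us

split-heads : (us : List (Vec Bool (suc m))) →
              us ↭ List.map (false ∷_) (tails false us) List.++ List.map (true ∷_) (tails true us)
split-heads []                 = refl
split-heads ((false ∷ u) ∷ us) = prep _ (split-heads us)
split-heads ((true ∷ u) ∷ us)  =
  ↭-trans (prep _ (split-heads us)) (↭-sym (shift _ (List.map (false ∷_) (tails false us)) _))

-- Inclusion–exclusion one coordinate at a time: vectors starting with true are counted by a difference.
#below-determines : ∀ (us vs : List (Vec Bool m)) → (∀ J → #below J us ≡ #below J vs) → us ↭ vs
#below-determines {zero} us vs eq = nullary us vs (trans (sym (all us)) (trans (eq []) (all vs)))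
  where
  all : (us : List (Vec Bool zero)) → #below [] us ≡ length us
  all []        = refl
  all ([] ∷ us) = cong suc (all us)
  nullary : (us vs : List (Vec Bool zero)) → length us ≡ length vs → us ↭ vs
  nullary []        []        _  = refl
  nullary ([] ∷ us) ([] ∷ vs) eq = prep [] (nullary us vs (ℕ.suc-injective eq))
#below-determines {suc m} us vs eq = begin
  us
    ↭⟨ split-heads us ⟩
  List.map (false ∷_) (tails false us) List.++ List.map (true ∷_) (tails true us)
    ↭⟨ ++⁺ (map⁺ _ (#below-determines (tails false us) (tails false vs) eq₀))
           (map⁺ _ (#below-determines (tails true us) (tails true vs) eq₁)) ⟩
  List.map (false ∷_) (tails false vs) List.++ List.map (true ∷_) (tails true vs)
    ↭⟨ split-heads vs ⟨
  vs ∎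
  where
  open PermutationReasoning
  eq₀ : ∀ J → #below J (tails false us) ≡ #below J (tails false vs)
  eq₀ J = trans (sym (#below-false J us)) (trans (eq (false ∷ J)) (#below-false J vs))
  eq₁ : ∀ J → #below J (tails true us) ≡ #below J (tails true vs)
  eq₁ J = ℕ.+-cancelˡ-≡ (#below J (tails false us)) _ _
    (trans (sym (#below-true J us)) (trans (eq (true ∷ J))
      (trans (#below-true J vs) (cong (_+ _) (sym (eq₀ J))))))

#below-map : ∀ {A : Set} (f : A → Vec Bool m) J xs →
             #below J (List.map f xs) ≡ length (filter (λ x → f x ⊑? J) xs)
#below-map f J []       = refl
#below-map f J (x ∷ xs) with does (f x ⊑? J)
... | true  = cong suc (#below-map f J xs)
... | false = #below-map f J xs

tabulate-map⁻ : ∀ {A B : Set} (f : Fin n → B) (g : A → B) xs → List.tabulate f ≡ List.map g xs →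
                Σ[ r ∈ (Fin n → A) ] (xs ≡ List.tabulate r × f ≗ g ∘ r)
tabulate-map⁻ {zero}  f g []       eq = (λ ()) , refl , λ ()
tabulate-map⁻ {suc n} f g (x ∷ xs) eq
  with r , refl , f≗gr ← tabulate-map⁻ (f ∘ suc) g xs (∷-injectiveʳ eq)
  = (λ where zero → x ; (suc i) → r i)
  , refl
  , λ where zero → ∷-injectiveˡ eq ; (suc i) → f≗gr i

-- The two injections make the counts below every `J` equal, so the lists of labels are
-- rearrangements of each other; this rearrangement is then lifted along `f` to the indices.
equidistributed⇒permutation :
  (f g : Fin N → Vec Bool m) →
  (∀ J → (λ x → f x ⊑ J) ≼ (λ x → g x ⊑ J)) →
  (∀ J → (λ x → g x ⊑ J) ≼ (λ x → f x ⊑ J)) →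
  Σ[ ρ ∈ Permutation′ N ] (∀ i → f i ≡ g (ρ ⟨$⟩ʳ i))
equidistributed⇒permutation {N} {m} f g f≼g g≼f = result
  where
  counts : ∀ J → #below J (List.map f (allFin N)) ≡ #below J (List.map g (allFin N))
  counts J = begin
    #below J (List.map f (allFin N))  ≡⟨ #below-map f J (allFin N) ⟩
    count (λ x → f x ⊑? J)            ≡⟨ ℕ.≤-antisym (count-mono _ _ (f≼g J)) (count-mono _ _ (g≼f J)) ⟩
    count (λ x → g x ⊑? J)            ≡⟨ #below-map g J (allFin N) ⟨
    #below J (List.map g (allFin N))  ∎
    where open ≡-Reasoning

  result : Σ[ ρ ∈ Permutation′ N ] (∀ i → f i ≡ g (ρ ⟨$⟩ʳ i))
  result
    with ys , eq , ↭ys ← ↭-map-inv f (#below-determines (List.map f (allFin N)) (List.map g (allFin N)) counts)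
    with r , refl , g≗fr ← tabulate-map⁻ g f ys (trans (sym (map-tabulate (λ i → i) g)) eq)
    = proj₁ ρ , λ i → begin
      f i                    ≡⟨ cong f (r∘s i) ⟩
      f (r (s i))            ≡⟨ g≗fr (s i) ⟨
      g (s i)                ≡⟨ cong g (proj₂ ρ i) ⟨
      g (proj₁ ρ ⟨$⟩ʳ i)     ∎
    where
    open ≡-Reasoning
    -- Every index occurs in the rearranged list `tabulate r`. Choosing a place for each gives a
    -- section of `r`, which is therefore injective.
    s : Fin N → Fin N
    s i = proj₁ (∈-tabulate⁻ (∈-resp-↭ ↭ys (∈-allFin i)))
    r∘s : ∀ i → i ≡ r (s i)
    r∘s i = proj₂ (∈-tabulate⁻ (∈-resp-↭ ↭ys (∈-allFin i)))
    ρ = injective⇒permutation s (λ {i} {j} eq → trans (r∘s i) (trans (cong r eq) (sym (r∘s j))))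

-- Ranking by keys

Monotone : (Fin n → ℕ) → Set
Monotone f = ∀ {u v} → u ≤ v → f u ℕ.≤ f v

-- If f (s v) < f v, then s maps the suc v indices up to v injectively below v.
monotone-rearrangement-≤ : ∀ (f : Fin n → ℕ) (s : Permutation′ n) →
                           Monotone f → Monotone (f ∘ (s ⟨$⟩ʳ_)) → ∀ v → f v ℕ.≤ f (s ⟨$⟩ʳ v)
monotone-rearrangement-≤ f s f-mono fs-mono v with f v ℕ.≤? f (s ⟨$⟩ʳ v)
... | yes fv≤fsv = fv≤fsv
... | no  fv≰fsv = contradiction (injective⇒≤ {f = h} h-injective) (ℕ.<⇒≱ (ℕ.n<1+n (toℕ v)))
  where
  emb : Fin (suc (toℕ v)) → Fin _
  emb i = inject≤ i (toℕ<n v)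
  s-below : ∀ i → s ⟨$⟩ʳ emb i < v
  s-below i = ℕ.≰⇒> λ v≤s → fv≰fsv (ℕ.≤-trans (f-mono v≤s)
    (fs-mono (subst (ℕ._≤ toℕ v) (sym (toℕ-inject≤ i (toℕ<n v))) (ℕ.≤-pred (toℕ<n i)))))
  h : Fin (suc (toℕ v)) → Fin (toℕ v)
  h i = fromℕ< (s-below i)
  h-injective : Injective _≡_ _≡_ h
  h-injective {i} {j} eq = inject≤-injective (toℕ<n v) (toℕ<n v) i j
    (permutation-injective s (toℕ-injective (fromℕ<-injective _ _ (s-below i) (s-below j) eq)))

monotone-rearrangement : ∀ (f : Fin n → ℕ) (s : Permutation′ n) →
                         Monotone f → Monotone (f ∘ (s ⟨$⟩ʳ_)) → ∀ v → f v ≡ f (s ⟨$⟩ʳ v)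
monotone-rearrangement f s f-mono fs-mono v = ℕ.≤-antisym
  (monotone-rearrangement-≤ f s f-mono fs-mono v)
  (subst (λ x → f (s ⟨$⟩ʳ v) ℕ.≤ f x) (inverseʳ s)
    (monotone-rearrangement-≤ (f ∘ (s ⟨$⟩ʳ_)) (flip s) fs-mono
      (λ {x} {y} x≤y → subst₂ (λ i j → f i ℕ.≤ f j) (sym (inverseʳ s)) (sym (inverseʳ s)) (f-mono x≤y)) v))

module _ (S : StrictTotalOrder 0ℓ 0ℓ 0ℓ) where
  private module S = StrictTotalOrder S

  -- The rank is the number of smaller keys; it is less than `n` because no key is below itself.
  ranking : (k : Fin n → S.Carrier) → (∀ {i j} → k i S.≈ k j → i ≡ j) →
            Σ[ π ∈ Permutation′ n ] (∀ {i j} → k i S.< k j → π ⟨$⟩ʳ i < π ⟨$⟩ʳ j)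
  ranking {n} k k-injective = π , λ {i} {j} ki<kj →
    subst₂ _<_ (sym (π≗rank i)) (sym (π≗rank j)) (rank-mono ki<kj)
    where
    below : Fin n → Subset n
    below i = tabulate λ j → does (k j S.<? k i)

    ∈below⁺ : ∀ {i j} → k j S.< k i → j Subset.∈ below i
    ∈below⁺ {i} {j} lt = lookup⇒[]= j (below i) (trans (lookup∘tabulate _ j) (dec-true (k j S.<? k i) lt))

    ∈below⁻ : ∀ {i j} → j Subset.∈ below i → k j S.< k i
    ∈below⁻ {i} {j} j∈
      with k j S.<? k i
         | trans (sym (lookup∘tabulate (λ j → does (k j S.<? k i)) j)) ([]=⇒lookup j∈)
    ... | yes lt | _ = lt

    ∣below∣<n : ∀ i → Subset.∣ below i ∣ ℕ.< n
    ∣below∣<n i = subst (Subset.∣ below i ∣ ℕ.<_) (∣⊤∣≡n n)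
      (p⊂q⇒∣p∣<∣q∣ ((λ _ → ∈⊤) , i , ∈⊤ , S.irrefl S.Eq.refl ∘ ∈below⁻))

    rank : Fin n → Fin n
    rank i = fromℕ< (∣below∣<n i)

    rank-mono : ∀ {i j} → k i S.< k j → rank i < rank j
    rank-mono {i} {j} lt = subst₂ ℕ._<_ (sym (toℕ-fromℕ< (∣below∣<n i))) (sym (toℕ-fromℕ< (∣below∣<n j)))
      (p⊂q⇒∣p∣<∣q∣
        ((λ x∈ → ∈below⁺ (S.trans (∈below⁻ x∈) lt)) , i , ∈below⁺ lt , S.irrefl S.Eq.refl ∘ ∈below⁻))

    rank-injective : Injective _≡_ _≡_ rank
    rank-injective {i} {j} eq with S.compare (k i) (k j)
    ... | tri< lt _ _ = contradiction eq (Fin.<⇒≢ (rank-mono lt))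
    ... | tri≈ _ ki≈kj _ = k-injective ki≈kj
    ... | tri> _ _ gt = contradiction (sym eq) (Fin.<⇒≢ (rank-mono gt))

    π = proj₁ (injective⇒permutation rank rank-injective)
    π≗rank = proj₂ (injective⇒permutation rank rank-injective)

Lexicographic : StrictTotalOrder 0ℓ 0ℓ 0ℓ
Lexicographic = <-strictTotalOrder ℕ.<-strictTotalOrder

open StrictTotalOrder Lexicographic using ()
  renaming (_<_ to _≺_; compare to ≺-compare; irrefl to ≺-irrefl)

-- Words and readings of a permutation

Word : ℕ → Set
Word n = Fin n → ℕ

-- One of the two ways of turning p into a sequence: position p i receives the
-- entry value p i.  Given a partition into blocks by b, the sequence
-- ascends on every block exactly when p ranks the positions i by their keys.
record Reading (m : ℕ) : Set where
  field
    tie-break : Word (suc m) → Fin (suc m) → List ℕ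
    value     : Permutation′ (suc m) → Fin (suc m) → ℕ
    least     : ℕ

  key : Word (suc m) → Fin (suc m) → List ℕ
  key w i = w i ∷ tie-break w i

  Sorted : (Fin (suc m) → ℕ) → Permutation′ (suc m) → Set
  Sorted b p = ∀ {i j} → key (b ∘ (p ⟨$⟩ʳ_)) i ≺ key (b ∘ (p ⟨$⟩ʳ_)) j → p ⟨$⟩ʳ i < p ⟨$⟩ʳ j

  Ascending : (Fin (suc m) → ℕ) → Permutation′ (suc m) → Set
  Ascending b p = ∀ {i j} → b (p ⟨$⟩ʳ i) ≡ b (p ⟨$⟩ʳ j) → p ⟨$⟩ʳ i < p ⟨$⟩ʳ j → value p i ℕ.< value p j

  field
    tie-break-cong   : ∀ {w w′} → w ≗ w′ → tie-break w ≗ tie-break w′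
    key-injective    : ∀ w {i j} → key w i ≡ key w j → i ≡ j
    last-first       : ∀ w {i} → i ≢ fromℕ m → tie-break w (fromℕ m) ≺ tie-break w i
    value-injective  : ∀ p {i j} → value p i ≡ value p j → i ≡ j
    value-last       : ∀ p → value p (fromℕ m) ≡ least
    ascending⇒sorted : ∀ {b p} → Monotone b → Ascending b p → Sorted b p
    sorted⇒ascending : ∀ {b p} → Sorted b p → Ascending b p

  key-cong : ∀ {w w′} → w ≗ w′ → key w ≗ key w′
  key-cong w≗w′ i = cong₂ _∷_ (w≗w′ i) (tie-break-cong w≗w′ i)

  -- Both permutations order the indices by the same keys, so the inverse of `p` followed by `p′`
  -- preserves the order of a finite chain and is the identity.
  sorted-unique : ∀ {b p p′} → Sorted b p → Sorted b p′ → (∀ i → b (p ⟨$⟩ʳ i) ≡ b (p′ ⟨$⟩ʳ i)) → p ≈ p′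
  sorted-unique {b} {p} {p′} sorted sorted′ bp≗bp′ i =
    subst (λ x → p ⟨$⟩ʳ i ≡ p′ ⟨$⟩ʳ x) (inverseˡ p)
      (toℕ-injective (monotone-rearrangement toℕ (flip p ∘ₚ p′) (λ u≤v → u≤v) mono (p ⟨$⟩ʳ i)))
    where
    w = b ∘ (p ⟨$⟩ʳ_)
    mono : Monotone (λ u → toℕ (p′ ⟨$⟩ʳ (p ⟨$⟩ˡ u)))
    mono {u} {v} u≤v with ≺-compare (key w (p ⟨$⟩ˡ u)) (key w (p ⟨$⟩ˡ v))
    ... | tri< lt _ _ = ℕ.<⇒≤ (sorted′ (subst₂ _≺_ (key-cong bp≗bp′ _) (key-cong bp≗bp′ _) lt))
    ... | tri≈ _ eq _ = ℕ.≤-reflexive (cong (λ x → toℕ (p′ ⟨$⟩ʳ x)) (key-injective w (Pointwise-≡⇒≡ eq)))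
    ... | tri> _ _ gt = contradiction u≤v (ℕ.<⇒≱ (subst₂ _<_ (inverseʳ p) (inverseʳ p) (sorted gt)))

  -- `q` ranks the keys of the word of `p`. Since letters are compared first, that word read along
  -- `q` is a monotone rearrangement of `b`, hence equal to `b`. So `q` has the same word as `p` and
  -- is sorted with respect to its own keys.
  sort : ∀ {b} → Monotone b → (p : Permutation′ (suc m)) →
         Σ[ q ∈ Permutation′ (suc m) ] ((∀ i → b (q ⟨$⟩ʳ i) ≡ b (p ⟨$⟩ʳ i)) × Sorted b q)
  sort {b} b-mono p = q , bq≗bp , λ lt → q-mono (subst₂ _≺_ (key-cong bq≗bp _) (key-cong bq≗bp _) lt)
    where
    w = b ∘ (p ⟨$⟩ʳ_)
    ranked = ranking Lexicographic (key w) (key-injective w ∘ Pointwise-≡⇒≡)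
    q = proj₁ ranked
    q-mono : ∀ {i j} → key w i ≺ key w j → q ⟨$⟩ʳ i < q ⟨$⟩ʳ j
    q-mono = proj₂ ranked
    wq-mono : Monotone (λ u → w (q ⟨$⟩ˡ u))
    wq-mono {u} {v} u≤v = ℕ.≮⇒≥ λ gt → ℕ.<⇒≱ (subst₂ _<_ (inverseʳ q) (inverseʳ q) (q-mono (this gt))) u≤v
    bq≗bp : ∀ i → b (q ⟨$⟩ʳ i) ≡ b (p ⟨$⟩ʳ i)
    bq≗bp i = trans (monotone-rearrangement b (flip q ∘ₚ p) b-mono wq-mono (q ⟨$⟩ʳ i))
                    (cong (λ x → b (p ⟨$⟩ʳ x)) (inverseˡ q))

  -- Within a block tie-breaks decide, and `last-first` gives the last index the smallest one. The
  -- least entry thus stands at the beginning of the block named by the last letter, a place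
  -- independent of the reading.
  last-minimal : ∀ {b p x} → Sorted b p → b x ≡ b (p ⟨$⟩ʳ fromℕ m) → p ⟨$⟩ʳ fromℕ m ≤ x
  last-minimal {b} {p} {x} sorted eq with p ⟨$⟩ˡ x ≟ fromℕ m
  ... | yes j≡last = ℕ.≤-reflexive (cong toℕ (trans (cong (p ⟨$⟩ʳ_) (sym j≡last)) (inverseʳ p)))
  ... | no  j≢last = ℕ.<⇒≤ (subst (p ⟨$⟩ʳ fromℕ m <_) (inverseʳ p)
    (sorted (next (sym (trans (cong b (inverseʳ p)) eq)) (last-first _ j≢last))))

  sequence : Permutation′ (suc m) → Fin (suc m) → ℕ
  sequence p x = value p (p ⟨$⟩ˡ x)

  sequence-injective : ∀ p → Injective _≡_ _≡_ (sequence p)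
  sequence-injective p eq = permutation-injective (flip p) (value-injective p eq)

-- Descents and blocks

descents : (Fin (suc m) → ℕ) → Vec Bool m
descents a = tabulate λ i → does (a (suc i) ℕ.<? a (inject₁ i))

positions : ℕ → (Fin n → ℕ) → Vec Bool n
positions z a = tabulate λ i → does (a i ℕ.≟ z)

-- x and y lie in the same block when no element of I separates them.
block : Vec Bool m → Fin (suc m) → ℕ
block I       zero    = 0
block (c ∷ I) (suc x) = (Bool.if c then 1 else 0) + block I x

block-mono : (I : Vec Bool m) → Monotone (block I)
block-mono I       {zero}          _         = ℕ.z≤n
block-mono (c ∷ I) {suc x} {suc y} (ℕ.s≤s x≤y) = ℕ.+-monoʳ-≤ (Bool.if c then 1 else 0) (block-mono I x≤y)

block-step : (I : Vec Bool m) (i : Fin m) → lookup I i ≡ false → block I (inject₁ i) ≡ block I (suc i)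
block-step (false ∷ I) zero    _  = refl
block-step (c ∷ I)     (suc i) eq = cong (_ +_) (block-step I i eq)

step⇒mono : ∀ (a : Fin (suc m) → ℕ) I → (∀ i → lookup I i ≡ false → a (inject₁ i) ℕ.≤ a (suc i)) →
            ∀ {x y} → block I x ≡ block I y → x ≤ y → a x ℕ.≤ a y
step⇒mono a I           step {zero}  {zero}  _  _             = ℕ.≤-refl
step⇒mono a (false ∷ I) step {zero}  {suc y} eq _             =
  ℕ.≤-trans (step zero refl) (step⇒mono (a ∘ suc) I (step ∘ suc) {zero} {y} eq ℕ.z≤n)
step⇒mono a (c ∷ I)     step {suc x} {suc y} eq (ℕ.s≤s x≤y) =
  step⇒mono (a ∘ suc) I (step ∘ suc) (ℕ.+-cancelˡ-≡ (Bool.if c then 1 else 0) _ _ eq) x≤y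

descents⊑⇒step : ∀ (a : Fin (suc m) → ℕ) I → descents a ⊑ I →
                 ∀ i → lookup I i ≡ false → a (inject₁ i) ℕ.≤ a (suc i)
descents⊑⇒step a I ⊑I i eq
  with does (a (suc i) ℕ.<? a (inject₁ i))
     | dec-true (a (suc i) ℕ.<? a (inject₁ i))
     | subst₂ Bool._≤_ (lookup∘tabulate (λ i → does (a (suc i) ℕ.<? a (inject₁ i))) i) eq (Pointwise.lookup ⊑I i)
... | false | ≢true | _ = ℕ.≮⇒≥ λ lt → contradiction (≢true lt) λ ()

step⇒descents⊑ : ∀ (a : Fin (suc m) → ℕ) I →
                 (∀ i → lookup I i ≡ false → a (inject₁ i) ℕ.≤ a (suc i)) → descents a ⊑ I
step⇒descents⊑ a I step = subst (descents a ⊑_) (tabulate∘lookup I) (Pointwise.tabulate⁺ bit)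
  where
  bit : ∀ i → does (a (suc i) ℕ.<? a (inject₁ i)) Bool.≤ lookup I i
  bit i with lookup I i in eq
  ... | true  = Bool.≤-maximum _
  ... | false = Bool.≤-reflexive (dec-false (a (suc i) ℕ.<? a (inject₁ i)) (ℕ.≤⇒≯ (step i eq)))

module _ (R : Reading m) where
  open Reading R

  -- Without descents outside `I` the sequence rises weakly on each block; its entries being
  -- distinct, the rise is strict.
  descents⊑⇒sorted : ∀ {p} I → descents (sequence p) ⊑ I → Sorted (block I) p
  descents⊑⇒sorted {p} I ⊑I = ascending⇒sorted (block-mono I) λ {i} {j} eq lt → ℕ.≤∧≢⇒<
    (subst₂ (λ i j → value p i ℕ.≤ value p j) (inverseˡ p) (inverseˡ p)
      (step⇒mono (sequence p) I (descents⊑⇒step (sequence p) I ⊑I) eq (ℕ.<⇒≤ lt)))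
    (λ vi≡vj → Fin.<⇒≢ lt (cong (p ⟨$⟩ʳ_) (value-injective p vi≡vj)))

  sorted⇒descents⊑ : ∀ {p} I → Sorted (block I) p → descents (sequence p) ⊑ I
  sorted⇒descents⊑ {p} I sorted = step⇒descents⊑ (sequence p) I λ i eq → ℕ.<⇒≤
    (sorted⇒ascending {b = block I} sorted
      (trans (cong (block I) (inverseʳ p)) (trans (block-step I i eq) (cong (block I) (sym (inverseʳ p)))))
      (subst₂ _<_ (sym (inverseʳ p)) (sym (inverseʳ p)) (ℕ.s≤s (ℕ.≤-reflexive (toℕ-inject₁ i)))))

  sequence≡least⁺ : ∀ {p x} → p ⟨$⟩ʳ fromℕ m ≡ x → sequence p x ≡ least
  sequence≡least⁺ {p} refl = trans (cong (value p) (inverseˡ p)) (value-last p)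

  sequence≡least⁻ : ∀ {p x} → sequence p x ≡ least → p ⟨$⟩ʳ fromℕ m ≡ x
  sequence≡least⁻ {p} eq = sequence-injective p (trans (sequence≡least⁺ {p} refl) (sym eq))

  sorted-resp-≈ : ∀ {b p q} → p ≈ q → Sorted b p → Sorted b q
  sorted-resp-≈ {b} p≈q sorted lt = subst₂ _<_ (p≈q _) (p≈q _)
    (sorted (subst₂ _≺_ (key-cong (cong b ∘ sym ∘ p≈q) _) (key-cong (cong b ∘ sym ∘ p≈q) _) lt))

-- Labels and their transfer between readings

-- Both statistics are stored in one vector, so a single matching of labels preserves them together.
label : ℕ → (Fin (suc m) → ℕ) → Vec Bool (suc m + m)
label z a = positions z a ++ descents a

readingLabel : Reading m → Permutation′ (suc m) → Vec Bool (suc m + m)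
readingLabel R p = label (Reading.least R) (Reading.sequence R p)

-- In either reading the least value stands exactly at the image of the last index.
same-positions : (R R′ : Reading m) (p q : Permutation′ (suc m)) → p ⟨$⟩ʳ fromℕ m ≡ q ⟨$⟩ʳ fromℕ m →
                 positions (Reading.least R) (Reading.sequence R p) ≡ positions (Reading.least R′) (Reading.sequence R′ q)
same-positions R R′ p q same-last = tabulate-cong λ x → does-⇔ (mk⇔
  (λ eq → sequence≡least⁺ R′ {q} (trans (sym same-last) (sequence≡least⁻ R {p} eq)))
  (λ eq → sequence≡least⁺ R {p} (trans same-last (sequence≡least⁻ R′ {q} eq))))
  (Reading.sequence R p x ℕ.≟ Reading.least R) (Reading.sequence R′ q x ℕ.≟ Reading.least R′)

module _ (perm : Fin N → Permutation′ (suc m))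
         (perm-injective : ∀ {i j} → perm i ≈ perm j → i ≡ j)
         (perm-surjective : ∀ p → ∃ λ i → perm i ≈ p) where

  module _ (R R′ : Reading m) (K : Vec Bool (suc m)) (I : Vec Bool m) where
    private
      module R  = Reading R
      module R′ = Reading R′
      b = block I

    -- Only the word of `perm i` survives; equal letters are ranked afresh by the tie-breaks of
    -- `R′`.
    resort : ∀ i → Σ[ j ∈ Fin N ] ((∀ x → b (perm j ⟨$⟩ʳ x) ≡ b (perm i ⟨$⟩ʳ x)) × R′.Sorted b (perm j))
    resort i = j , (λ x → trans (cong b (pj≈q x)) (proj₁ (proj₂ sorted) x)) ,
      sorted-resp-≈ R′ {b} {q} {perm j} (sym ∘ pj≈q) (proj₂ (proj₂ sorted))
      where
      sorted = R′.sort {b} (block-mono I) (perm i)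
      q      = proj₁ sorted
      j      = proj₁ (perm-surjective q)
      pj≈q   = proj₂ (perm-surjective q)

    positions⊑ : ∀ i → readingLabel R (perm i) ⊑ (K ++ I) → positions R.least (R.sequence (perm i)) ⊑ K
    positions⊑ i = Pointwise.++ˡ⁻ (positions R.least (R.sequence (perm i))) K

    sorted : ∀ i → readingLabel R (perm i) ⊑ (K ++ I) → R.Sorted b (perm i)
    sorted i ⊑J = descents⊑⇒sorted R {perm i} I
      (Pointwise.++ʳ⁻ (positions R.least (R.sequence (perm i))) K ⊑J)

    -- The last letters agree, and each of the two images comes first in that block, so each is at
    -- most the other.
    same-last : ∀ i → R.Sorted b (perm i) → perm i ⟨$⟩ʳ fromℕ m ≡ perm (proj₁ (resort i)) ⟨$⟩ʳ fromℕ m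
    same-last i sorted = Fin.≤-antisym
      (R.last-minimal {b} {perm i} sorted (proj₁ (proj₂ (resort i)) _))
      (R′.last-minimal {b} {perm (proj₁ (resort i))} (proj₂ (proj₂ (resort i))) (sym (proj₁ (proj₂ (resort i)) _)))

    resorted : ∀ i → readingLabel R (perm i) ⊑ (K ++ I) → ∃ λ j → readingLabel R′ (perm j) ⊑ (K ++ I)
    resorted i ⊑J = proj₁ (resort i) , Pointwise.++⁺
      (subst (_⊑ K) (same-positions R R′ (perm i) (perm (proj₁ (resort i))) (same-last i (sorted i ⊑J))) (positions⊑ i ⊑J))
      (sorted⇒descents⊑ R′ {perm (proj₁ (resort i))} I (proj₂ (proj₂ (resort i))))

    -- Equal results have equal words, and a sorted permutation is determined by its word.
    resorted-injective : ∀ {i i′} → R.Sorted b (perm i) → R.Sorted b (perm i′) →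
                         proj₁ (resort i) ≡ proj₁ (resort i′) → i ≡ i′
    resorted-injective {i} {i′} sorted sorted′ j≡j′ = perm-injective
      (R.sorted-unique {b} {perm i} {perm i′} sorted sorted′ λ x → begin
        b (perm i ⟨$⟩ʳ x)                      ≡⟨ proj₁ (proj₂ (resort i)) x ⟨
        b (perm (proj₁ (resort i)) ⟨$⟩ʳ x)     ≡⟨ cong (λ j → b (perm j ⟨$⟩ʳ x)) j≡j′ ⟩
        b (perm (proj₁ (resort i′)) ⟨$⟩ʳ x)    ≡⟨ proj₁ (proj₂ (resort i′)) x ⟩
        b (perm i′ ⟨$⟩ʳ x)                     ∎)
      where open ≡-Reasoning

    readings-≼ : (λ i → readingLabel R (perm i) ⊑ (K ++ I)) ≼ (λ i → readingLabel R′ (perm i) ⊑ (K ++ I))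
    readings-≼ = resorted , λ {i} {j} pi pj → resorted-injective (sorted i pi) (sorted j pj)

-- Ranking suffixes of words

after : Word (suc m) → Fin (suc m) → List ℕ
after         w zero    = List.tabulate (w ∘ suc)
after {suc m} w (suc i) = after (w ∘ suc) i

after-cong : ∀ {w w′ : Word (suc m)} → w ≗ w′ → after w ≗ after w′
after-cong         w≗w′ zero    = List.tabulate-cong (w≗w′ ∘ suc)
after-cong {suc m} w≗w′ (suc i) = after-cong (w≗w′ ∘ suc) i

after-last : ∀ (w : Word (suc m)) → after w (fromℕ m) ≡ []
after-last {zero}  w = refl
after-last {suc m} w = after-last (w ∘ suc)

after-inject₁ : ∀ (w : Word (suc m)) i → after w (inject₁ i) ≡ w (suc i) ∷ after w (suc i)
after-inject₁ {suc m} w zero    = refl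
after-inject₁ {suc m} w (suc i) = after-inject₁ (w ∘ suc) i

length-after : ∀ (w : Word (suc m)) i → List.length (after w i) ≡ toℕ (opposite i)
length-after {m}     w zero    = trans (length-tabulate (w ∘ suc)) (sym (toℕ-fromℕ m))
length-after {suc m} w (suc i) = trans (length-after (w ∘ suc) i) (sym (toℕ-inject₁ (opposite i)))

opposite-injective : ∀ {i j : Fin n} → opposite i ≡ opposite j → i ≡ j
opposite-injective {i = i} {j} eq = trans (sym (opposite-involutive i)) (trans (cong opposite eq) (opposite-involutive j))

opposite-fromℕ : ∀ m → opposite (fromℕ m) ≡ zero
opposite-fromℕ m = opposite-involutive zero

successor : Permutation′ (suc m) → Fin (suc m) → ℕ
successor p i with view i
... | ‵fromℕ     = 0
... | ‵inject₁ j = suc (toℕ (p ⟨$⟩ʳ suc j))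

successor-last : ∀ (p : Permutation′ (suc m)) → successor p (fromℕ m) ≡ 0
successor-last {m} p rewrite view-fromℕ m = refl

successor-inject₁ : ∀ (p : Permutation′ (suc m)) j → successor p (inject₁ j) ≡ suc (toℕ (p ⟨$⟩ʳ suc j))
successor-inject₁ p j rewrite view-inject₁ j = refl

successor-injective : ∀ (p : Permutation′ (suc m)) {i j} → successor p i ≡ successor p j → i ≡ j
successor-injective p {i} {j} eq with view i | view j
... | ‵fromℕ     | ‵fromℕ     = refl
... | ‵inject₁ i | ‵inject₁ j =
  cong inject₁ (Fin.suc-injective (permutation-injective p (toℕ-injective (ℕ.suc-injective eq))))

module _ {b : Fin n → ℕ} {p : Permutation′ n} {t : Fin n → List ℕ} {v : Fin n → ℕ} where
  private
    key : Fin n → List ℕ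
    key i = b (p ⟨$⟩ʳ i) ∷ t i

  -- Different letters are settled by monotonicity of `b`. For equal letters, images in the wrong
  -- order would by ascent put the values in the wrong order too, against the tie-breaks.
  key-mono : Monotone b → ∀ {i j} → (b (p ⟨$⟩ʳ j) ≡ b (p ⟨$⟩ʳ i) → p ⟨$⟩ʳ j < p ⟨$⟩ʳ i → v j ℕ.< v i) →
             (t i ≺ t j → v i ℕ.< v j) → key i ≺ key j → p ⟨$⟩ʳ i < p ⟨$⟩ʳ j
  key-mono b-mono {i} {j} asc t≺⇒v< (this lt) = ℕ.≰⇒> (ℕ.<⇒≱ lt ∘ b-mono)
  key-mono b-mono {i} {j} asc t≺⇒v< (next eq lt) with <-cmp (p ⟨$⟩ʳ i) (p ⟨$⟩ʳ j)
  ... | tri< pi<pj _ _ = pi<pj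
  ... | tri≈ _ pi≡pj _ = contradiction (t≺⇒v< lt) (ℕ.<-irrefl (cong v (permutation-injective p pi≡pj)))
  ... | tri> _ _ pi>pj = contradiction (asc (sym eq) pi>pj) (ℕ.<-asym (t≺⇒v< lt))

  value-mono : (∀ {i j} → key i ≡ key j → i ≡ j) → (∀ {i j} → key i ≺ key j → p ⟨$⟩ʳ i < p ⟨$⟩ʳ j) →
               ∀ {i j} → (t i ≺ t j → v i ℕ.< v j) → b (p ⟨$⟩ʳ i) ≡ b (p ⟨$⟩ʳ j) → p ⟨$⟩ʳ i < p ⟨$⟩ʳ j → v i ℕ.< v j
  value-mono key-injective sorted {i} {j} t≺⇒v< bpi≡bpj pi<pj with ≺-compare (key i) (key j)
  ... | tri< (this lt)   _  _  = contradiction lt (ℕ.<-irrefl bpi≡bpj)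
  ... | tri< (next _ lt) _  _  = t≺⇒v< lt
  ... | tri≈ _           eq _  = contradiction pi<pj (Fin.<-irrefl (cong (p ⟨$⟩ʳ_) (key-injective (Pointwise-≡⇒≡ eq))))
  ... | tri> _           _  gt = contradiction (sorted gt) (ℕ.<-asym pi<pj)

after-injective : ∀ (w : Word (suc m)) {i j} → after w i ≡ after w j → i ≡ j
after-injective w {i} {j} eq = opposite-injective (toℕ-injective
  (trans (sym (length-after w i)) (trans (cong List.length eq) (length-after w j))))

suffixes : ∀ m → Reading m
suffixes m = record
  { tie-break        = after
  ; value            = successor
  ; least            = 0
  ; tie-break-cong   = after-cong
  ; key-injective    = λ w eq → after-injective w (∷-injectiveʳ eq)
  ; last-first       = last-first
  ; value-injective  = successor-injective
  ; value-last       = successor-last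
  ; ascending⇒sorted = λ {b} {p} → ascending⇒sorted b p
  ; sorted⇒ascending = λ {b} {p} → sorted⇒ascending b p
  }
  where
  last-first : ∀ (w : Word (suc m)) {i} → i ≢ fromℕ m → after w (fromℕ m) ≺ after w i
  last-first w {i} i≢last with view i
  ... | ‵fromℕ     = contradiction refl i≢last
  ... | ‵inject₁ j = subst₂ _≺_ (sym (after-last w)) (sym (after-inject₁ w j)) halt

  module _ (b : Fin (suc m) → ℕ) (p : Permutation′ (suc m)) where
    w : Word (suc m)
    w = b ∘ (p ⟨$⟩ʳ_)

    key : Fin (suc m) → List ℕ
    key i = w i ∷ after w i

    after≺⇒successor<-last : ∀ {j} → after w (fromℕ m) ≺ after w j → successor p (fromℕ m) ℕ.< successor p j
    after≺⇒successor<-last {j} lt with view j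
    ... | ‵fromℕ     = contradiction lt (≺-irrefl (≡⇒Pointwise-≡ refl))
    ... | ‵inject₁ j = subst (ℕ._< suc (toℕ (p ⟨$⟩ʳ suc j))) (sym (successor-last p)) ℕ.z<s

    -- The tie-break at `inject₁ i` is the key of `suc i`, and the value there is one more than the
    -- image of `suc i`. Comparing tie-breaks is thus comparing keys one index further on.
    after≺⇒successor<-inject₁ : ∀ i {j} → (∀ {k} → key (suc i) ≺ key k → p ⟨$⟩ʳ suc i < p ⟨$⟩ʳ k) →
                                after w (inject₁ i) ≺ after w j → successor p (inject₁ i) ℕ.< successor p j
    after≺⇒successor<-inject₁ i {j} mono lt with view j
    ... | ‵fromℕ     = contradiction (subst (after w (inject₁ i) ≺_) (after-last w) lt) xs≮[]
    ... | ‵inject₁ j = subst (ℕ._< suc (toℕ (p ⟨$⟩ʳ suc j))) (sym (successor-inject₁ p i))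
      (ℕ.s<s (mono (subst₂ _≺_ (after-inject₁ w i) (after-inject₁ w j) lt)))

    ascending⇒sorted : Monotone b →
      (∀ {i j} → w i ≡ w j → p ⟨$⟩ʳ i < p ⟨$⟩ʳ j → successor p i ℕ.< successor p j) →
      ∀ {i j} → key i ≺ key j → p ⟨$⟩ʳ i < p ⟨$⟩ʳ j
    -- The induction descends from the last index, because the order of keys at an index rests on
    -- that at the next one.
    ascending⇒sorted b-mono asc {i} {j} = >-weakInduction (λ i → ∀ j → key i ≺ key j → p ⟨$⟩ʳ i < p ⟨$⟩ʳ j)
      (λ j → step after≺⇒successor<-last)
      (λ i mono j → step (after≺⇒successor<-inject₁ i (λ {k} → mono k)))
      i j
      where
      step : ∀ {i j} → (after w i ≺ after w j → successor p i ℕ.< successor p j) → key i ≺ key j → p ⟨$⟩ʳ i < p ⟨$⟩ʳ j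
      step = key-mono {p = p} {after w} {successor p} b-mono asc

    sorted⇒ascending :
      (∀ {i j} → key i ≺ key j → p ⟨$⟩ʳ i < p ⟨$⟩ʳ j) →
      ∀ {i j} → w i ≡ w j → p ⟨$⟩ʳ i < p ⟨$⟩ʳ j → successor p i ℕ.< successor p j
    sorted⇒ascending sorted {i} {j} = value-mono {b = b} {p} {after w} {successor p}
      (after-injective w ∘ ∷-injectiveʳ) sorted after≺⇒successor<
      where
      after≺⇒successor< : ∀ {i j} → after w i ≺ after w j → successor p i ℕ.< successor p j
      -- The comparison of the next keys comes from `sorted` itself; the induction only separates
      -- the last index from the others.
      after≺⇒successor< {i} {j} lt = >-weakInduction (λ i → after w i ≺ after w j → successor p i ℕ.< successor p j)
        after≺⇒successor<-last (λ i _ → after≺⇒successor<-inject₁ i sorted) i lt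

-- The reading that produces σ. Its value is the successor of its one-letter tie-break, so the two
-- compare alike without any induction.
opposites : ∀ m → Reading m
opposites m = record
  { tie-break        = λ _ i → toℕ (opposite i) ∷ []
  ; value            = λ _ i → suc (toℕ (opposite i))
  ; least            = 1
  ; tie-break-cong   = λ _ _ → refl
  ; key-injective    = λ _ eq → opposite-injective (toℕ-injective (∷-injectiveˡ (∷-injectiveʳ eq)))
  ; last-first       = λ _ {i} i≢last → this (subst (ℕ._< toℕ (opposite i)) (sym (cong toℕ (opposite-fromℕ m)))
      (ℕ.n≢0⇒n>0 λ eq → i≢last (opposite-injective (trans (toℕ-injective eq) (sym (opposite-fromℕ m))))))
  ; value-injective  = λ _ eq → opposite-injective (toℕ-injective (ℕ.suc-injective eq))
  ; value-last       = λ _ → cong (suc ∘ toℕ) (opposite-fromℕ m)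
  ; ascending⇒sorted = λ {b} {p} b-mono asc → key-mono {p = p} b-mono asc singleton≺⇒<
  ; sorted⇒ascending = λ {b} {p} sorted → value-mono {b = b} {p}
      (λ eq → opposite-injective (toℕ-injective (∷-injectiveˡ (∷-injectiveʳ eq)))) sorted singleton≺⇒<
  }
  where
  singleton≺⇒< : ∀ {x y} → (x ∷ []) ≺ (y ∷ []) → suc x ℕ.< suc y
  singleton≺⇒< (this lt)      = ℕ.s<s lt
  singleton≺⇒< (next _ []≺[]) = contradiction []≺[] xs≮[]

module Suffixes {m} = Reading (suffixes m)

-- Cycles with one entry replaced by zero

rotate : Fin (suc m) → Fin (suc m)
rotate {m} i = suc (toℕ i) mod suc m

rotate-fromℕ : ∀ m → rotate (fromℕ m) ≡ zero
rotate-fromℕ m = toℕ-injective (trans (toℕ-fromℕ< (m%n<n (suc (toℕ (fromℕ m))) (suc m)))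
  (trans (cong (λ x → suc x % suc m) (toℕ-fromℕ m)) (n%n≡0 (suc m))))

rotate-inject₁ : ∀ (i : Fin m) → rotate (inject₁ i) ≡ suc i
rotate-inject₁ {m} i = toℕ-injective (trans (toℕ-fromℕ< (m%n<n (suc (toℕ (inject₁ i))) (suc m)))
  (trans (cong (λ x → suc x % suc m) (toℕ-inject₁ i)) (m<n⇒m%n≡m (ℕ.s<s (toℕ<n i)))))

rotate-injective : Injective _≡_ _≡_ (rotate {m})
rotate-injective {m} {i} {j} eq with view i | view j
... | ‵fromℕ     | ‵fromℕ     = refl
... | ‵fromℕ     | ‵inject₁ j = contradiction (trans (sym (rotate-fromℕ m)) (trans eq (rotate-inject₁ j))) λ ()
... | ‵inject₁ i | ‵fromℕ     = contradiction (trans (sym (rotate-inject₁ i)) (trans eq (rotate-fromℕ m))) λ ()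
... | ‵inject₁ i | ‵inject₁ j = cong inject₁ (Fin.suc-injective (trans (sym (rotate-inject₁ i)) (trans eq (rotate-inject₁ j))))

rotation : Permutation′ (suc m)
rotation = proj₁ (injective⇒permutation rotate rotate-injective)

infix 4 _CyclesAlong_

_CyclesAlong_ : Permutation′ (suc m) → Permutation′ (suc m) → Set
π CyclesAlong p = ∀ i → π ⟨$⟩ʳ (p ⟨$⟩ʳ i) ≡ p ⟨$⟩ʳ rotate i

-- A cycle can be written from any starting point. Each precomposition with `rotation` shifts the
-- indices by one, which is why the induction quantifies over `p`.
cyclesAlong-ending-at : ∀ {π p : Permutation′ (suc m)} → π CyclesAlong p → ∀ i →
                        ∃ λ q → π CyclesAlong q × q ⟨$⟩ʳ fromℕ m ≡ p ⟨$⟩ʳ i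
cyclesAlong-ending-at {m} {π} {p} cyc i = <-weakInduction Ending base step i p cyc
  where
  Ending : Fin (suc m) → Set
  Ending i = ∀ p → π CyclesAlong p → ∃ λ q → π CyclesAlong q × q ⟨$⟩ʳ fromℕ m ≡ p ⟨$⟩ʳ i
  base : Ending zero
  base p cyc = rotation ∘ₚ p , cyc ∘ rotate , cong (p ⟨$⟩ʳ_) (rotate-fromℕ m)
  step : ∀ i → Ending (inject₁ i) → Ending (suc i)
  step i ending p cyc with q , cyc′ , eq ← ending (rotation ∘ₚ p) (cyc ∘ rotate)
    = q , cyc′ , trans eq (cong (p ⟨$⟩ʳ_) (rotate-inject₁ i))

lookup-oneLine : ∀ (π : Permutation′ n) x → lookup (oneLine π) x ≡ suc (toℕ (π ⟨$⟩ʳ x))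
lookup-oneLine π = lookup∘tabulate (λ i → suc (toℕ (π ⟨$⟩ʳ i)))

lookup-cycle-with-zero : ∀ {π p : Permutation′ (suc m)} → π CyclesAlong p →
                         lookup (oneLine π [ p ⟨$⟩ʳ fromℕ m ]≔ 0) ≗ Suffixes.sequence p
lookup-cycle-with-zero {m} {π} {p} cyc x =
  trans (cong (lookup (oneLine π [ p ⟨$⟩ʳ fromℕ m ]≔ 0)) (sym (inverseʳ p))) (at (p ⟨$⟩ˡ x))
  where
  at : ∀ i → lookup (oneLine π [ p ⟨$⟩ʳ fromℕ m ]≔ 0) (p ⟨$⟩ʳ i) ≡ successor p i
  at i with view i
  ... | ‵fromℕ     = lookup∘update (p ⟨$⟩ʳ fromℕ m) (oneLine π) 0
  ... | ‵inject₁ j = begin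
    lookup (oneLine π [ p ⟨$⟩ʳ fromℕ m ]≔ 0) (p ⟨$⟩ʳ inject₁ j)  ≡⟨ lookup∘update′ not-last (oneLine π) 0 ⟩
    lookup (oneLine π) (p ⟨$⟩ʳ inject₁ j)                        ≡⟨ lookup-oneLine π (p ⟨$⟩ʳ inject₁ j) ⟩
    suc (toℕ (π ⟨$⟩ʳ (p ⟨$⟩ʳ inject₁ j)))                        ≡⟨ cong (suc ∘ toℕ) (cyc (inject₁ j)) ⟩
    suc (toℕ (p ⟨$⟩ʳ rotate (inject₁ j)))                        ≡⟨ cong (λ i → suc (toℕ (p ⟨$⟩ʳ i))) (rotate-inject₁ j) ⟩
    suc (toℕ (p ⟨$⟩ʳ suc j))                                     ∎
    where
    open ≡-Reasoning
    not-last : p ⟨$⟩ʳ inject₁ j ≢ p ⟨$⟩ʳ fromℕ m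
    not-last eq = fromℕ≢inject₁ (sym (permutation-injective p eq))

-- The cycle is rotated until it ends at the position of the zero. The conclusion covers every
-- `q ≈ p` because an enumeration recovers `p` only up to `≈`.
𝒯⁰⇒sequence : ∀ {a : Vec ℕ (suc m)} → Is𝒯⁰ a → ∃ λ p → ∀ {q} → q ≈ p → lookup a ≗ Suffixes.sequence q
𝒯⁰⇒sequence {m} (π , k , (c , cyc) , refl)
  with p , cyc′ , end ← cyclesAlong-ending-at {π = π} {c} cyc (c ⟨$⟩ˡ k)
  = p , λ {q} q≈p → subst (λ k → lookup (oneLine π [ k ]≔ 0) ≗ Suffixes.sequence q)
      (trans (q≈p (fromℕ m)) (trans end (inverseʳ c)))
      (lookup-cycle-with-zero {π = π} {q}
        (λ i → trans (cong (π ⟨$⟩ʳ_) (q≈p i)) (trans (cyc′ i) (sym (q≈p (rotate i))))))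

sequence∈𝒯⁰ : ∀ (p : Permutation′ (suc m)) → Is𝒯⁰ (tabulate (Suffixes.sequence p))
sequence∈𝒯⁰ {m} p = π , p ⟨$⟩ʳ fromℕ m , (p , cyc) ,
  trans (tabulate-cong (sym ∘ lookup-cycle-with-zero {π = π} {p} cyc)) (tabulate∘lookup (oneLine π [ p ⟨$⟩ʳ fromℕ m ]≔ 0))
  where
  -- Conjugating `rotation` by `p` gives the cycle that runs through the values of `p` in order.
  π = flip p ∘ₚ rotation ∘ₚ p
  cyc : π CyclesAlong p
  cyc i = cong (λ i → p ⟨$⟩ʳ rotate i) (inverseˡ p)

-- The zero locates the last entry of p, and each entry determines the preceding one.
sequence-determines : ∀ {p q : Permutation′ (suc m)} → Suffixes.sequence p ≗ Suffixes.sequence q → p ≈ q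
sequence-determines {m} {p} {q} eq = >-weakInduction _ (determined ends-equal) λ i eq′ → determined (begin
    successor p (inject₁ i)   ≡⟨ successor-inject₁ p i ⟩
    suc (toℕ (p ⟨$⟩ʳ suc i))  ≡⟨ cong (suc ∘ toℕ) eq′ ⟩
    suc (toℕ (q ⟨$⟩ʳ suc i))  ≡⟨ successor-inject₁ q i ⟨
    successor q (inject₁ i)   ∎)
  where
  open ≡-Reasoning
  ends-equal : successor p (fromℕ m) ≡ successor q (fromℕ m)
  ends-equal = trans (successor-last p) (sym (successor-last q))
  determined : ∀ {i} → successor p i ≡ successor q i → p ⟨$⟩ʳ i ≡ q ⟨$⟩ʳ i
  determined {i} same = Suffixes.sequence-injective q (begin
    Suffixes.sequence q (p ⟨$⟩ʳ i)  ≡⟨ eq (p ⟨$⟩ʳ i) ⟨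
    Suffixes.sequence p (p ⟨$⟩ʳ i)  ≡⟨ cong (successor p) (inverseˡ p) ⟩
    successor p i                   ≡⟨ same ⟩
    successor q i                   ≡⟨ cong (successor q) (inverseˡ q) ⟨
    Suffixes.sequence q (q ⟨$⟩ʳ i)  ∎)

-- The bijection

flip-cong : ∀ {p q : Permutation′ n} → p ≈ q → flip p ≈ flip q
flip-cong {p = p} {q} p≈q x = permutation-injective p
  (trans (inverseʳ p) (trans (sym (inverseʳ q)) (sym (p≈q (q ⟨$⟩ˡ x)))))

does-transport : ∀ {A B : Set} (a? : Dec A) (b? : Dec B) → does a? ≡ does b? → A → B
does-transport _       (yes b) _  _ = b
does-transport (no ¬a) (no _)  _  a = contradiction a ¬a

tabulate-injective : ∀ {A : Set} {f g : Fin n → A} → tabulate f ≡ tabulate g → f ≗ g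
tabulate-injective {f = f} {g} eq i =
  trans (sym (lookup∘tabulate f i)) (trans (cong (λ v → lookup v i) eq) (lookup∘tabulate g i))

label-cong : ∀ z {a a′ : Fin (suc m) → ℕ} → a ≗ a′ → label z a ≡ label z a′
label-cong z a≗a′ = cong₂ _++_
  (tabulate-cong λ i → cong (λ x → does (x ℕ.≟ z)) (a≗a′ i))
  (tabulate-cong λ i → cong₂ (λ x y → does (x ℕ.<? y)) (a≗a′ (suc i)) (a≗a′ (inject₁ i)))

label⇒D : ∀ {z z′} (a a′ : Vec ℕ (suc m)) → label z (lookup a) ≡ label z′ (lookup a′) →
          (D a ≐ D a′) × (∀ k → lookup a k ≡ z → lookup a′ k ≡ z′)
label⇒D {z = z} {z′} a a′ eq
  with same-positions , same-descents ← ++-injective (positions z (lookup a)) (positions z′ (lookup a′)) eq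
  = ( (λ {i} → does-transport (_ ℕ.<? _) (_ ℕ.<? _) (tabulate-injective same-descents i))
    , (λ {i} → does-transport (_ ℕ.<? _) (_ ℕ.<? _) (sym (tabulate-injective same-descents i))))
  , λ k → does-transport (lookup a k ℕ.≟ z) (lookup a′ k ℕ.≟ z′)
      (tabulate-injective {f = λ k → does (lookup a k ℕ.≟ z)} {λ k → does (lookup a′ k ℕ.≟ z′)} same-positions k)

module _ {N} (perm : Fin N → Permutation′ (suc m))
         (perm-injective : ∀ {i j} → perm i ≈ perm j → i ≡ j)
         (perm-surjective : ∀ p → ∃ λ i → perm i ≈ p) where

  private
    matching : Σ[ ρ ∈ Permutation′ N ]
      (∀ i → readingLabel (suffixes m) (perm i) ≡ readingLabel (opposites m) (perm (ρ ⟨$⟩ʳ i)))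
    matching = equidistributed⇒permutation _ _
      (readings-≼′ (suffixes m) (opposites m))
      (readings-≼′ (opposites m) (suffixes m))
      where
      readings-≼′ : ∀ R R′ J → (λ i → readingLabel R (perm i) ⊑ J) ≼ (λ i → readingLabel R′ (perm i) ⊑ J)
      readings-≼′ R R′ J with K , I , refl ← Vec.splitAt (suc m) J =
        readings-≼ perm perm-injective perm-surjective R R′ K I

    ρ = proj₁ matching

    open Setoid (𝒯⁰ (suc m)) using () renaming (Carrier to T)

    code : T → Fin N
    code (a , a∈) = proj₁ (perm-surjective (proj₁ (𝒯⁰⇒sequence a∈)))

    lookup≗sequence : ∀ (τ : T) → lookup (proj₁ τ) ≗ Suffixes.sequence (perm (code τ))
    lookup≗sequence (a , a∈) = proj₂ (𝒯⁰⇒sequence a∈) (proj₂ (perm-surjective (proj₁ (𝒯⁰⇒sequence a∈))))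

    -- Makes `code` independent of the cycle and the position chosen in the membership proof, hence
    -- a function of the sequence alone.
    code-unique : ∀ τ {i} → lookup (proj₁ τ) ≗ Suffixes.sequence (perm i) → code τ ≡ i
    code-unique τ eq = perm-injective (sequence-determines λ x → trans (sym (lookup≗sequence τ x)) (eq x))

    code-cong : ∀ {τ τ′ : T} → proj₁ τ ≡ proj₁ τ′ → code τ ≡ code τ′
    code-cong {τ} {τ′} refl = code-unique τ (lookup≗sequence τ′)

    code-injective : ∀ {τ τ′ : T} → code τ ≡ code τ′ → proj₁ τ ≡ proj₁ τ′
    code-injective {τ} {τ′} eq = begin
      proj₁ τ                                         ≡⟨ tabulate∘lookup (proj₁ τ) ⟨
      tabulate (lookup (proj₁ τ))                     ≡⟨ tabulate-cong (lookup≗sequence τ) ⟩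
      tabulate (Suffixes.sequence (perm (code τ)))    ≡⟨ cong (tabulate ∘ Suffixes.sequence ∘ perm) eq ⟩
      tabulate (Suffixes.sequence (perm (code τ′)))   ≡⟨ tabulate-cong (lookup≗sequence τ′) ⟨
      tabulate (lookup (proj₁ τ′))                    ≡⟨ tabulate∘lookup (proj₁ τ′) ⟩
      proj₁ τ′                                        ∎
      where open ≡-Reasoning

    -- Its one-line notation is, entry by entry, the `opposites` sequence of `q`.
    fromReading : Permutation′ (suc m) → Permutation′ (suc m)
    fromReading q = flip q ∘ₚ reverse

    fromReading-injective : ∀ {p q} → fromReading p ≈ fromReading q → p ≈ q
    fromReading-injective {p} {q} eq = flip-cong {p = flip p} {flip q} (opposite-injective ∘ eq)

    to : T → Permutation′ (suc m)
    to τ = fromReading (perm (ρ ⟨$⟩ʳ code τ))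

    to-injective : ∀ τ τ′ → to τ ≈ to τ′ → proj₁ τ ≡ proj₁ τ′
    to-injective τ τ′ eq = code-injective {τ} {τ′} (permutation-injective ρ (perm-injective
      (fromReading-injective {perm (ρ ⟨$⟩ʳ code τ)} {perm (ρ ⟨$⟩ʳ code τ′)} eq)))

    to-surjective : ∀ σ → ∃ λ (τ : T) → ∀ {τ′ : T} → proj₁ τ′ ≡ proj₁ τ → to τ′ ≈ σ
    to-surjective σ = (tabulate (Suffixes.sequence (perm i)) , sequence∈𝒯⁰ (perm i)) , λ {τ′} eq x → begin
      opposite (perm (ρ ⟨$⟩ʳ code τ′) ⟨$⟩ˡ x)   ≡⟨ cong (λ i → opposite (perm (ρ ⟨$⟩ʳ i) ⟨$⟩ˡ x)) (same-code τ′ eq) ⟩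
      opposite (perm (ρ ⟨$⟩ʳ i) ⟨$⟩ˡ x)         ≡⟨ cong (λ j → opposite (perm j ⟨$⟩ˡ x)) (inverseʳ ρ) ⟩
      opposite (perm j ⟨$⟩ˡ x)                  ≡⟨ cong opposite (flip-cong {p = perm j} {q} (proj₂ (perm-surjective q)) x) ⟩
      opposite (opposite (σ ⟨$⟩ʳ x))            ≡⟨ opposite-involutive (σ ⟨$⟩ʳ x) ⟩
      σ ⟨$⟩ʳ x                                  ∎
      where
      open ≡-Reasoning
      -- This solves `fromReading q ≈ σ`, since inversion and reversal are involutions.
      q = reverse ∘ₚ flip σ
      j = proj₁ (perm-surjective q)
      i = ρ ⟨$⟩ˡ j
      same-code : ∀ (τ′ : T) → proj₁ τ′ ≡ tabulate (Suffixes.sequence (perm i)) → code τ′ ≡ i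
      same-code τ′ eq = code-unique τ′ λ x →
        trans (cong (λ a → lookup a x) eq) (lookup∘tabulate (Suffixes.sequence (perm i)) x)

  φ : Bijection (𝒯⁰ (suc m)) (𝒮 (suc m))
  φ = record
    { to        = to
    ; cong      = λ {τ} {τ′} eq x → cong (λ i → fromReading (perm (ρ ⟨$⟩ʳ i)) ⟨$⟩ʳ x) (code-cong {τ} {τ′} eq)
    ; bijective = (λ {τ} {τ′} eq → to-injective τ τ′ eq) , to-surjective
    }

  φ-label : ∀ τ → label 0 (lookup (proj₁ τ)) ≡ label 1 (lookup (oneLine (Bijection.to φ τ)))
  φ-label τ = begin
    label 0 (lookup (proj₁ τ))                         ≡⟨ label-cong 0 (lookup≗sequence τ) ⟩
    readingLabel (suffixes m) (perm (code τ))          ≡⟨ proj₂ matching (code τ) ⟩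
    readingLabel (opposites m) (perm (ρ ⟨$⟩ʳ code τ))  ≡⟨ label-cong 1 (lookup-oneLine (to τ)) ⟨
    label 1 (lookup (oneLine (to τ)))                  ∎
    where open ≡-Reasoning

  φ-preserves : ∀ τ → let σ = Bijection.to φ τ in
                (D (proj₁ τ) ≐ D (oneLine σ)) × (∀ k → lookup (proj₁ τ) k ≡ 0 → lookup (oneLine σ) k ≡ 1)
  φ-preserves τ = label⇒D (proj₁ τ) (oneLine (to τ)) (φ-label τ)

corollary4p3 : ∀ (n : ℕ) .{{_ : NonZero n}} →
    Σ[ φ′ ∈ Bijection (𝒯⁰ n) (𝒮 n) ]
    (∀ (τ : Setoid.Carrier (𝒯⁰ n)) →
    let σ = Bijection.to φ′ τ in
    (D (proj₁ τ) ≐ D (oneLine σ)) ×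
    (∀ k → lookup (proj₁ τ) k ≡ 0 → lookup (oneLine σ) k ≡ 1))
corollary4p3 zero {{()}}
corollary4p3 (suc m) =
    φ perm injective surjective
  , φ-preserves perm injective surjective
  where
  perm       = enumerate (suc m)
  injective  : ∀ {i j} → perm i ≈ perm j → i ≡ j
  injective  = enumerate-injective (suc m)
  surjective = enumerate-surjective (suc m)
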